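{- Let $r \ge 0$ be a fixed integer. There is a constant $C>0$ (depending only on $r$) such that for every $r$-rank connected graph $G$ with vertex set $V=[n]$, there exists a hypergraph $H$ on $[n]$ with at most $C n^{r+1}$ hyperedges (i.e. $\mathcal O(n^{r+1})$ hyperedges) such that $\mathrm{cl}_r(H) = H_r(G)$.
   Context: For a graph $G=(V,E)$ and $X\subseteq V$, write $\overline X = V\setminus X$. The cut-rank $\rho(X)$ is the rank over the two-element field $\mathbb{F}_2$ of the submatrix of the adjacency matrix of $G$ with rows indexed by $X$ and columns indexed by $\overline X$. A set $X\subseteq V$ (identified with the cut $(X,\overline X)$) is a $k$-split if $\rho(X)\le k$; it is trivial if $\rho(X)=\min(|X|,|\overline X|)$. $G$ is $r$-rank connected if every $k$-split with $k<r$ is trivial. $H_r(G)$ is the hypergraph with vertex set $[n]$ whose hyperedges are all $r$-splits of $G$. A hypergraph on $[n]$ is identified with its set of hyperedges (subsets of $[n]$). $\mathcal K_r(n)$ is the class of hypergraphs $\mathcal E$ on $V=[n]$ such that: (R0) every $X\subseteq V$ with $|X|\le r$ is in $\mathcal E$; (R1) if $A\in\mathcal E$ then $V\setminus A\in\mathcal E$; (R2) if $A,B\in\mathcal E$ and $|A\cap B|\ge r$ then $A\cup B\in\mathcal E$. For a hypergraph $H$ on $[n]$, $\mathrm{cl}_r(H)$ is the intersection of all hypergraphs in $\mathcal K_r(n)$ containing $H$. -}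

module Defs where

open import Algebra.Bundles using (CommutativeRing)
open import Data.Bool.Base using (Bool; false; T; _∧_)
open import Data.Bool.Properties using (xor-∧-commutativeRing) renaming (_≟_ to _≟ᵇ_)
open import Data.Fin.Base using (Fin)
open import Data.Fin.Subset using (Subset; Lift; _⊆_; ∣_∣; ∁; ⊥; _∩_; _∪_; inside; outside)
open import Data.Fin.Subset.Properties using (_⊆?_; Lift?; anySubset?)
open import Data.List.Base using (List; []; _∷_; _++_; map; filter; filterᵇ; length)
open import Data.List.Extrema.Nat using (max)
open import Data.Nat.Base using (ℕ; zero; suc; _≤_; _<_; _⊓_)
open import Data.Nat.Properties using (_≤?_)
open import Data.Product.Base using (_×_; _,_)
open import Data.Vec.Base as Vec using (lookup)
open import Data.Vec.Properties using (≡-dec)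
open import Function.Base using (_∘_)
open import Level using (0ℓ)
open import Relation.Binary.PropositionalEquality.Core using (_≡_)
open import Relation.Nullary.Decidable using (Dec; does; map′; ¬?; _→-dec_; _×-dec_; decidable-stable)
open import Relation.Unary using (Pred; Decidable) renaming (_⊆_ to _⊆ᴾ_)

-- The field 𝔽₂ is Bool with addition _xor_ and multiplication _∧_.
open import Algebra.Properties.CommutativeMonoid.Sum
  (CommutativeRing.+-commutativeMonoid xor-∧-commutativeRing) using (sum)

private
  variable
    m n : ℕ

subsets : ∀ n → List (Subset n)
subsets zero    = Vec.[] ∷ []
subsets (suc n) =
  map (inside Vec.∷_) (subsets n) ++ map (outside Vec.∷_) (subsets n)

allSubsets? : {P : Pred (Subset n) 0ℓ} → Decidable P → Dec (∀ S → P S)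
allSubsets? P? = map′
  (λ ∄¬P S → decidable-stable (P? S) (∄¬P ∘ (S ,_)))
  (λ ∀P (S , ¬PS) → ¬PS (∀P S))
  (¬? (anySubset? (¬? ∘ P?)))

Matrix : ℕ → ℕ → Set
Matrix m n = Fin m → Fin n → Bool

-- A coefficient vector over 𝔽₂ supported on S is the same thing as a subset
-- c ⊆ S, lookup c i being the coefficient of row i.  The relation says that
-- this linear combination of the rows vanishes on all columns in Y.
Vanishes : Matrix m n → Subset n → Subset m → Set
Vanishes M Y c = Lift (λ j → sum (λ i → lookup c i ∧ M i j) ≡ false) Y

-- The family of rows indexed by S, restricted to the columns in Y, is
-- linearly independent over 𝔽₂.
Independent : Matrix m n → Subset n → Subset m → Set
Independent M Y S = ∀ c → c ⊆ S × Vanishes M Y c → c ≡ ⊥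

independent? : (M : Matrix m n) (Y : Subset n) → Decidable (Independent M Y)
independent? M Y S = allSubsets? λ c →
  (c ⊆? S ×-dec Lift? (λ j → sum (λ i → lookup c i ∧ M i j) ≟ᵇ false) Y)
  →-dec ≡-dec _≟ᵇ_ c ⊥

-- Rank over 𝔽₂ of the submatrix with rows X and columns Y: the maximal
-- number of linearly independent rows.  The base value 0 does not matter,
-- since the empty family of rows is always independent.
rank : Matrix m n → Subset m → Subset n → ℕ
rank {m} M X Y = max 0
  (map ∣_∣ (filter (λ S → S ⊆? X ×-dec independent? M Y S) (subsets m)))

record Graph (n : ℕ) : Set where
  field
    adj         : Matrix n n
    symmetric   : ∀ u v → adj u v ≡ adj v u
    irreflexive : ∀ v → adj v v ≡ false

open Graph public

cutRank : Graph n → Subset n → ℕ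
cutRank G X = rank (adj G) X (∁ X)

IsSplit : Graph n → ℕ → Pred (Subset n) 0ℓ
IsSplit G k X = cutRank G X ≤ k

Trivial : Graph n → Pred (Subset n) 0ℓ
Trivial G X = cutRank G X ≡ ∣ X ∣ ⊓ ∣ ∁ X ∣

RankConnected : ℕ → Graph n → Set
RankConnected r G = ∀ k X → k < r → IsSplit G k X → Trivial G X

-- A set of subsets of the vertex set, given by its characteristic function.
Hypergraph : ℕ → Set
Hypergraph n = Subset n → Bool

Edges : Hypergraph n → Pred (Subset n) 0ℓ
Edges ℰ X = T (ℰ X)

numEdges : Hypergraph n → ℕ
numEdges ℰ = length (filterᵇ ℰ (subsets _))

splitHypergraph : ℕ → Graph n → Hypergraph n
splitHypergraph r G X = does (cutRank G X ≤? r)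

record 𝒦 (r : ℕ) (ℰ : Hypergraph n) : Set where
  field
    R0 : ∀ X → ∣ X ∣ ≤ r → Edges ℰ X
    R1 : ∀ A → Edges ℰ A → Edges ℰ (∁ A)
    R2 : ∀ A B → Edges ℰ A → Edges ℰ B → r ≤ ∣ A ∩ B ∣ → Edges ℰ (A ∪ B)

-- The intersection of all members of 𝒦 r containing H, as a set of edges.
cl : ℕ → Hypergraph n → Pred (Subset n) 0ℓ
cl r H X = ∀ ℰ → 𝒦 r ℰ → Edges H ⊆ᴾ Edges ℰ → Edges ℰ X

module Submission where

-- By submodularity of the cut-rank, the r-splits of an r-rank connected graph satisfy
-- (R0)–(R2).  By (R1) and (R2), two r-splits avoiding a common set Z with at least r elements
-- have an r-split as intersection, so among the r-splits containing S and avoiding Z there is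
-- a smallest one, hull Z S.  Generators: the hulls with ∣ S ∣ ≤ r + 1 and Z contained in a
-- fixed set Z₀ of 2r vertices, so that the choice of Z only costs the constant 4 ^ r.
-- Given an r-split X, one of X and its complement avoids at least r elements of Z₀; assume X
-- avoids Z = Z₀ ∖ X, ∣ Z ∣ ≥ r.  For S ⊆ X with r elements, X is the union over v ∈ X of the
-- hulls of S ∪ {v}, and any two of these share the r elements of S, so (R2) applies.

open import Defs
open import Algebra.Bundles using (CommutativeRing)
import Algebra.Lattice.Properties.BooleanAlgebra as BooleanAlgebra
open import Data.Bool.Base using (Bool; true; false; _∧_; _xor_; T)
open import Data.Bool.Properties
  using (xor-assoc; xor-comm; xor-same; xor-identityˡ; xor-identityʳ; ∧-distribʳ-xor;
         ∧-zeroʳ; ∧-identityʳ; xor-∧-commutativeRing)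
  renaming (_≟_ to _≟ᵇ_)
open import Data.Empty using (⊥-elim)
open import Data.Fin.Base using (Fin; zero; suc)
open import Data.Fin.Properties using () renaming (any? to anyFin?)
open import Data.Fin.Subset
  using (Subset; _∈_; _∉_; _⊆_; ∣_∣; ∁; ⊥; ⊤; ⁅_⁆; _∩_; _∪_; ⋂; inside; outside)
open import Data.Fin.Subset.Properties
open import Data.List.Base
  using (List; []; _∷_; _++_; map; filter; length; cartesianProduct;
         cartesianProductWith; allFin)
open import Data.List.Extrema.Nat using (argmax-sel; xs≤max)
import Data.List.Membership.DecPropositional as DecMembership
open import Data.List.Membership.Propositional using () renaming (_∈_ to _∈ᴸ_)
open import Data.List.Membership.Propositional.Properties
  using (∈-∃++; ∈-++⁺ˡ; ∈-++⁺ʳ; ∈-++⁻; ∈-map⁺; ∈-map⁻; ∈-filter⁺; ∈-filter⁻;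
         ∈-cartesianProduct⁺; ∈-cartesianProduct⁻; ∈-cartesianProductWith⁺; ∈-allFin)
open import Data.List.Properties
  using (length-++; length-++-sucʳ; length-map; length-filter; length-tabulate)
open import Data.List.Relation.Unary.All as All using (All; []; _∷_)
open import Data.List.Relation.Unary.All.Properties using (all-filter)
open import Data.List.Relation.Unary.AllPairs using ([]; _∷_)
open import Data.List.Relation.Unary.Any using (here; there)
open import Data.List.Relation.Unary.Unique.Propositional using (Unique)
import Data.List.Relation.Unary.Unique.Propositional.Properties as Unique
open import Data.Nat.Base using (ℕ; zero; suc; _≤_; _<_; _*_; _^_; _+_; _∸_; _⊓_; z≤n; s≤s)
open import Data.Nat.Properties
open import Data.Product.Base using (_×_; _,_; proj₁; proj₂; ∃-syntax)
open import Data.Product.Properties using (,-injective)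
open import Data.Sum.Base using (_⊎_; inj₁; inj₂; [_,_]′)
open import Data.Vec.Base as Vec using (lookup; zipWith; tabulate)
  renaming ([] to []ᵛ; _∷_ to _∷ᵛ_)
open import Data.Vec.Properties as Vec
  using (lookup-zipWith; lookup⇒[]=; []=⇒lookup; lookup∘tabulate; zipWith-assoc;
         zipWith-comm; zipWith-identityˡ; zipWith-identityʳ)
open import Function.Base using (_∘_; id; flip)
open import Level using (0ℓ)
open import Relation.Binary.PropositionalEquality
open import Relation.Nullary.Decidable
  using (Dec; yes; no; does; _×-dec_; ¬?; T?; decidable-stable)
open import Relation.Nullary.Negation using (¬_; contradiction)
open import Relation.Unary using (Pred; Decidable; _≐_) renaming (_⊆_ to _⊆ᴾ_)

open import Algebra.Properties.CommutativeMonoid.Sum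
  (CommutativeRing.+-commutativeMonoid xor-∧-commutativeRing)
  using (sum; sum-cong-≗; sum-replicate-zero; ∑-distrib-+; ∑-comm)

private
  variable
    m n : ℕ
    A B C : Set

-- Counting lists and subsets.

length-injection : {xs : List A} {ys : List B} (f : A → B) → Unique xs →
  (∀ {x} → x ∈ᴸ xs → f x ∈ᴸ ys) →
  (∀ {x x′} → x ∈ᴸ xs → x′ ∈ᴸ xs → f x ≡ f x′ → x ≡ x′) →
  length xs ≤ length ys
length-injection f [] maps inj = z≤n
length-injection {xs = x ∷ xs} f (x∉xs ∷ u) maps inj
  -- One occurrence of `f x` is removed from the target list; injectivity and uniqueness of `x` keep
  -- the images of the remaining entries inside what is left.
  with ys₁ , ys₂ , refl ← ∈-∃++ (maps (here refl)) =
  subst (suc (length xs) ≤_) (sym (length-++-sucʳ ys₁ (f x) ys₂))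
    (s≤s (length-injection f u maps′ (λ p q → inj (there p) (there q))))
  where
  maps′ : ∀ {x′} → x′ ∈ᴸ xs → f x′ ∈ᴸ ys₁ ++ ys₂
  maps′ p with ∈-++⁻ ys₁ (maps (there p))
  ... | inj₁ q         = ∈-++⁺ˡ q
  ... | inj₂ (there q) = ∈-++⁺ʳ ys₁ q
  ... | inj₂ (here eq) =
    contradiction (inj (here refl) (there p) (sym eq)) (All.lookup x∉xs p)

length-cartesianProductWith : (f : A → B → C) (xs : List A) (ys : List B) →
  length (cartesianProductWith f xs ys) ≡ length xs * length ys
length-cartesianProductWith f []       ys = refl
length-cartesianProductWith f (x ∷ xs) ys = trans (length-++ (map (f x) ys))
  (cong₂ _+_ (length-map (f x) ys) (length-cartesianProductWith f xs ys))

2^-cancel-≤ : ∀ {a b} → 2 ^ a ≤ 2 ^ b → a ≤ b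
2^-cancel-≤ h = ≮⇒≥ λ b<a → <⇒≱ (^-monoʳ-< 2 (s≤s (s≤s z≤n)) b<a) h

-- These are the coefficient vectors supported on `S`, listed without repetition, so that dimensions
-- over 𝔽₂ can be compared through lengths that are powers of two.
powerset : Subset n → List (Subset n)
powerset []ᵛ            = []ᵛ ∷ []
powerset (inside  ∷ᵛ S) = map (inside ∷ᵛ_) (powerset S) ++ map (outside ∷ᵛ_) (powerset S)
powerset (outside ∷ᵛ S) = map (outside ∷ᵛ_) (powerset S)

length-powerset : (S : Subset n) → length (powerset S) ≡ 2 ^ ∣ S ∣
length-powerset []ᵛ = refl
length-powerset (inside ∷ᵛ S) = begin
  length (map (inside ∷ᵛ_) (powerset S) ++ map (outside ∷ᵛ_) (powerset S))
    ≡⟨ length-++ (map (inside ∷ᵛ_) (powerset S)) ⟩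
  length (map (inside ∷ᵛ_) (powerset S)) + length (map (outside ∷ᵛ_) (powerset S))
    ≡⟨ cong₂ _+_ (length-map _ (powerset S)) (length-map _ (powerset S)) ⟩
  length (powerset S) + length (powerset S)
    ≡⟨ cong₂ _+_ (length-powerset S) (trans (length-powerset S) (sym (+-identityʳ _))) ⟩
  2 ^ suc ∣ S ∣ ∎
  where open ≡-Reasoning
length-powerset (outside ∷ᵛ S) = trans (length-map _ (powerset S)) (length-powerset S)

∈-powerset⁺ : (S : Subset n) {c : Subset n} → c ⊆ S → c ∈ᴸ powerset S
∈-powerset⁺ []ᵛ            {[]ᵛ}          c⊆S = here refl
∈-powerset⁺ (inside  ∷ᵛ S) {inside  ∷ᵛ c} c⊆S =
  ∈-++⁺ˡ (∈-map⁺ _ (∈-powerset⁺ S (drop-∷-⊆ c⊆S)))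
∈-powerset⁺ (inside  ∷ᵛ S) {outside ∷ᵛ c} c⊆S =
  ∈-++⁺ʳ _ (∈-map⁺ _ (∈-powerset⁺ S (drop-∷-⊆ c⊆S)))
∈-powerset⁺ (outside ∷ᵛ S) {inside  ∷ᵛ c} c⊆S with () ← c⊆S Vec.here
∈-powerset⁺ (outside ∷ᵛ S) {outside ∷ᵛ c} c⊆S =
  ∈-map⁺ _ (∈-powerset⁺ S (drop-∷-⊆ c⊆S))

∈-powerset⁻ : (S : Subset n) {c : Subset n} → c ∈ᴸ powerset S → c ⊆ S
∈-powerset⁻ []ᵛ (here refl) = id
∈-powerset⁻ (inside ∷ᵛ S) p with ∈-++⁻ (map (inside ∷ᵛ_) (powerset S)) p
... | inj₁ q with c , c∈ , refl ← ∈-map⁻ _ q = in⊆in (∈-powerset⁻ S c∈)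
... | inj₂ q with c , c∈ , refl ← ∈-map⁻ _ q = out⊆ (∈-powerset⁻ S c∈)
∈-powerset⁻ (outside ∷ᵛ S) p with c , c∈ , refl ← ∈-map⁻ _ p = out⊆ (∈-powerset⁻ S c∈)

unique-powerset : (S : Subset n) → Unique (powerset S)
unique-powerset []ᵛ = [] ∷ []
unique-powerset (inside ∷ᵛ S) =
  Unique.++⁺ (Unique.map⁺ Vec.∷-injectiveʳ (unique-powerset S))
             (Unique.map⁺ Vec.∷-injectiveʳ (unique-powerset S))
             (λ (p , q) → disjoint (∈-map⁻ _ p) (∈-map⁻ _ q))
  where
  disjoint : ∀ {c} → ∃[ a ] (a ∈ᴸ powerset S × c ≡ inside ∷ᵛ a) →
             ¬ (∃[ a ] (a ∈ᴸ powerset S × c ≡ outside ∷ᵛ a))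
  disjoint (_ , _ , refl) (_ , _ , ())
unique-powerset (outside ∷ᵛ S) = Unique.map⁺ Vec.∷-injectiveʳ (unique-powerset S)

subsets≡powerset-⊤ : ∀ n → subsets n ≡ powerset ⊤
subsets≡powerset-⊤ zero    = refl
subsets≡powerset-⊤ (suc n) =
  cong (λ ss → map (inside ∷ᵛ_) ss ++ map (outside ∷ᵛ_) ss) (subsets≡powerset-⊤ n)

∈-subsets : (S : Subset n) → S ∈ᴸ subsets n
∈-subsets S = subst (S ∈ᴸ_) (sym (subsets≡powerset-⊤ _)) (∈-powerset⁺ ⊤ (λ _ → ∈⊤))

unique-subsets : ∀ n → Unique (subsets n)
unique-subsets n = subst Unique (sym (subsets≡powerset-⊤ n)) (unique-powerset ⊤)

-- A total choice function, so that in `kernel-modular` the chosen part is determined by `u ⊕ w`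
-- alone. For the list members to which the injections are applied a witness exists, and the default
-- `⊥` is not met.
choose : {P : Pred (Subset n) 0ℓ} → Decidable P → Subset n
choose P? with anySubset? P?
... | yes (c , _) = c
... | no  _       = ⊥

choose-sat : {P : Pred (Subset n) 0ℓ} (P? : Decidable P) {c : Subset n} → P c → P (choose P?)
choose-sat P? Pc with anySubset? P?
... | yes (_ , Pd) = Pd
... | no  ∄P       = contradiction (_ , Pc) ∄P

-- Linear algebra over 𝔽₂

infixl 6 _⊕_

-- Addition of coefficient vectors, that is, symmetric difference.
_⊕_ : Subset n → Subset n → Subset n
_⊕_ = zipWith _xor_

⊕-assoc : (a b c : Subset n) → (a ⊕ b) ⊕ c ≡ a ⊕ (b ⊕ c)
⊕-assoc = zipWith-assoc xor-assoc

⊕-comm : (a b : Subset n) → a ⊕ b ≡ b ⊕ a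
⊕-comm = zipWith-comm xor-comm

⊕-identityˡ : (a : Subset n) → ⊥ ⊕ a ≡ a
⊕-identityˡ = zipWith-identityˡ xor-identityˡ

⊕-identityʳ : (a : Subset n) → a ⊕ ⊥ ≡ a
⊕-identityʳ = zipWith-identityʳ xor-identityʳ

⊕-same : (a : Subset n) → a ⊕ a ≡ ⊥
⊕-same []ᵛ      = refl
⊕-same (x ∷ᵛ a) = cong₂ _∷ᵛ_ (xor-same x) (⊕-same a)

⊕-cancelʳ : (a b : Subset n) → (a ⊕ b) ⊕ b ≡ a
⊕-cancelʳ a b = trans (⊕-assoc a b b) (trans (cong (a ⊕_) (⊕-same b)) (⊕-identityʳ a))

⊕-cancelˡ : (a b : Subset n) → a ⊕ (a ⊕ b) ≡ b
⊕-cancelˡ a b = trans (sym (⊕-assoc a a b)) (trans (cong (_⊕ b) (⊕-same a)) (⊕-identityˡ b))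

⊕≡⊥⇒≡ : (a b : Subset n) → a ⊕ b ≡ ⊥ → a ≡ b
⊕≡⊥⇒≡ a b eq = trans (sym (⊕-cancelʳ a b)) (trans (cong (_⊕ b) eq) (⊕-identityˡ b))

∈-⊕⁻ : (a b : Subset n) {x : Fin n} → x ∈ a ⊕ b → x ∈ a ⊎ x ∈ b
∈-⊕⁻ a b {x} p with lookup a x in eqa | lookup b x in eqb
... | true  | _     = inj₁ (lookup⇒[]= x a eqa)
... | false | true  = inj₂ (lookup⇒[]= x b eqb)
... | false | false
  with () ← trans (sym ([]=⇒lookup p)) (trans (lookup-zipWith _xor_ x a b) (cong₂ _xor_ eqa eqb))

x∉⁅x⁆⊕a : (a : Subset n) {x : Fin n} → x ∈ a → x ∉ ⁅ x ⁆ ⊕ a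
x∉⁅x⁆⊕a a {x} x∈a p
  with () ← trans (sym ([]=⇒lookup p)) (trans (lookup-zipWith _xor_ x ⁅ x ⁆ a)
              (cong₂ _xor_ ([]=⇒lookup (x∈⁅x⁆ x)) ([]=⇒lookup x∈a)))

⊕-⊆ : (a b : Subset n) {S : Subset n} → a ⊆ S → b ⊆ S → a ⊕ b ⊆ S
⊕-⊆ a b a⊆S b⊆S p = [ a⊆S , b⊆S ]′ (∈-⊕⁻ a b p)

⁅x⁆⊆ : {x : Fin n} {S : Subset n} → x ∈ S → ⁅ x ⁆ ⊆ S
⁅x⁆⊆ {x = x} {S} x∈S p = subst (_∈ S) (sym (x∈⁅y⁆⇒x≡y x p)) x∈S

-- A set is the sum of the singletons of its elements. In `basis-spans` this carries spanning from
-- single rows to all their combinations.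
⊕-induction : (P : Pred (Subset n) 0ℓ) → P ⊥ → (∀ a b → P a → P b → P (a ⊕ b)) →
  (S : Subset n) → (∀ {x} → x ∈ S → P ⁅ x ⁆) → P S
⊕-induction P P⊥ P⊕ []ᵛ      P⁅⁆ = P⊥
⊕-induction P P⊥ P⊕ (b ∷ᵛ S) P⁅⁆ = cases b P⁅⁆
  where
  P-tail : P (outside ∷ᵛ S)
  P-tail = ⊕-induction (P ∘ (outside ∷ᵛ_)) P⊥ (λ a b → P⊕ (outside ∷ᵛ a) (outside ∷ᵛ b))
    S (P⁅⁆ ∘ Vec.there)
  cases : ∀ b → (∀ {x} → x ∈ b ∷ᵛ S → P ⁅ x ⁆) → P (b ∷ᵛ S)
  cases outside P⁅⁆ = P-tail
  cases inside  P⁅⁆ = subst P (cong (inside ∷ᵛ_) (⊕-identityˡ S))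
    (P⊕ _ _ (P⁅⁆ Vec.here) P-tail)

-- The standard bilinear pairing. With `g` a column it is the sum in `Vanishes`; with `g` a row it
-- is the entry of a column combination.
⟨_,_⟩ : Subset n → (Fin n → Bool) → Bool
⟨ c , g ⟩ = sum (λ i → lookup c i ∧ g i)

⟨,⟩-⊕ : (a b : Subset n) (g : Fin n → Bool) → ⟨ a ⊕ b , g ⟩ ≡ ⟨ a , g ⟩ xor ⟨ b , g ⟩
⟨,⟩-⊕ a b g = trans
  (sum-cong-≗ λ i → trans (cong (_∧ g i) (lookup-zipWith _xor_ i a b))
                          (∧-distribʳ-xor (g i) (lookup a i) (lookup b i)))
  (∑-distrib-+ (λ i → lookup a i ∧ g i) (λ i → lookup b i ∧ g i))

⟨,⟩-zero : (c : Subset n) {g : Fin n → Bool} → (∀ {i} → i ∈ c → g i ≡ false) →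
  ⟨ c , g ⟩ ≡ false
⟨,⟩-zero {n} c {g} g-vanishes = trans (sum-cong-≗ term) (sum-replicate-zero n)
  where
  term : ∀ i → lookup c i ∧ g i ≡ false
  term i with lookup c i in eq
  ... | true  = g-vanishes (lookup⇒[]= i c eq)
  ... | false = refl

⟨,⟩-⁅⁆ : (x : Fin n) (g : Fin n → Bool) → ⟨ ⁅ x ⁆ , g ⟩ ≡ g x
⟨,⟩-⁅⁆ zero g = trans
  (cong (g zero xor_) (⟨,⟩-zero ⊥ {g ∘ suc} (λ p → contradiction p ∉⊥)))
  (xor-identityʳ (g zero))
⟨,⟩-⁅⁆ (suc x) g = ⟨,⟩-⁅⁆ x (g ∘ suc)

∧-distribˡ-sum : ∀ a (f : Fin n → Bool) → a ∧ sum f ≡ sum (λ i → a ∧ f i)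
∧-distribˡ-sum     true  f = refl
∧-distribˡ-sum {n} false f = sym (sum-replicate-zero n)

-- Interchanging the two sums trades combinations of columns for combinations of rows.
⟨,⟩-adjoint : (M : Matrix m n) (c : Subset m) (d : Subset n) →
  ⟨ c , (λ i → ⟨ d , M i ⟩) ⟩ ≡ ⟨ d , (λ j → ⟨ c , (λ i → M i j) ⟩) ⟩
⟨,⟩-adjoint M c d = begin
  sum (λ i → lookup c i ∧ sum (λ j → lookup d j ∧ M i j))
    ≡⟨ sum-cong-≗ (λ i → ∧-distribˡ-sum (lookup c i) (λ j → lookup d j ∧ M i j)) ⟩
  sum (λ i → sum (λ j → lookup c i ∧ (lookup d j ∧ M i j)))
    ≡⟨ ∑-comm (λ i j → lookup c i ∧ (lookup d j ∧ M i j)) ⟩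
  sum (λ j → sum (λ i → lookup c i ∧ (lookup d j ∧ M i j)))
    ≡⟨ sum-cong-≗ (λ j → sum-cong-≗ (λ i → ∧-swap (lookup c i) (lookup d j) (M i j))) ⟩
  sum (λ j → sum (λ i → lookup d j ∧ (lookup c i ∧ M i j)))
    ≡⟨ sum-cong-≗ (λ j → ∧-distribˡ-sum (lookup d j) (λ i → lookup c i ∧ M i j)) ⟨
  sum (λ j → lookup d j ∧ sum (λ i → lookup c i ∧ M i j)) ∎
  where
  open ≡-Reasoning
  ∧-swap : ∀ x y z → x ∧ (y ∧ z) ≡ y ∧ (x ∧ z)
  ∧-swap true  y z = refl
  ∧-swap false y z = sym (∧-zeroʳ y)

-- Independent rows and bases.

module _ (M : Matrix m n) (Y : Subset n) where

  vanishes? : Decidable (Vanishes M Y)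
  vanishes? c = Lift? (λ j → ⟨ c , (λ i → M i j) ⟩ ≟ᵇ false) Y

  vanishes-⊥ : Vanishes M Y ⊥
  vanishes-⊥ {j} _ = ⟨,⟩-zero ⊥ {λ i → M i j} (λ p → contradiction p ∉⊥)

  vanishes-⊕ : ∀ a b → Vanishes M Y a → Vanishes M Y b → Vanishes M Y (a ⊕ b)
  vanishes-⊕ a b va vb j∈Y = trans (⟨,⟩-⊕ a b _) (cong₂ _xor_ (va j∈Y) (vb j∈Y))

  independent-⊥ : Independent M Y ⊥
  independent-⊥ c (c⊆⊥ , _) = ⊆-antisym c⊆⊥ ⊥⊆

  module _ (X : Subset m) where

    private
      candidate? : Decidable (λ S → S ⊆ X × Independent M Y S)
      candidate? S = S ⊆? X ×-dec independent? M Y S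

      sizes : List ℕ
      sizes = map ∣_∣ (filter candidate? (subsets m))

    independent⇒∣∣≤rank : ∀ {S} → S ⊆ X → Independent M Y S → ∣ S ∣ ≤ rank M X Y
    independent⇒∣∣≤rank {S} S⊆X indS =
      All.lookup (xs≤max 0 sizes) (∈-map⁺ ∣_∣ (∈-filter⁺ candidate? (∈-subsets S) (S⊆X , indS)))

    -- The maximum of a list is either attained or equal to the base value 0; in the second case the
    -- empty family attains it.
    basis : ∃[ S ] (S ⊆ X × Independent M Y S × ∣ S ∣ ≡ rank M X Y)
    basis with argmax-sel id 0 sizes
    ... | inj₁ rank≡0 = ⊥ , ⊥⊆ , independent-⊥ , trans (∣⊥∣≡0 m) (sym rank≡0)
    ... | inj₂ p with S , S∈ , eq ← ∈-map⁻ ∣_∣ {xs = filter candidate? (subsets m)} p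
                 with _ , S⊆X , indS ← ∈-filter⁻ candidate? {xs = subsets m} S∈ =
      S , S⊆X , indS , sym eq

    -- A maximum independent set of rows spans: a row x outside its span could be added to it.
    basis-spans : ∀ {S} → S ⊆ X → Independent M Y S → ∣ S ∣ ≡ rank M X Y →
      ∀ {c} → c ⊆ X → ∃[ s ] (s ⊆ S × Vanishes M Y (c ⊕ s))
    basis-spans {S} S⊆X indS ∣S∣≡rank {c} c⊆X =
      ⊕-induction (λ c → ∃[ s ] (s ⊆ S × Vanishes M Y (c ⊕ s)))
        (⊥ , ⊥⊆ , subst (Vanishes M Y) (sym (⊕-same ⊥)) vanishes-⊥)
        add c
        -- Being spanned by `S` is decidable by finite search, so it may be proved by contradiction.
        (λ {x} x∈c → decidable-stable
          (anySubset? (λ s → s ⊆? S ×-dec vanishes? (⁅ x ⁆ ⊕ s))) (single (c⊆X x∈c)))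
      where
      add : ∀ a b → ∃[ s ] (s ⊆ S × Vanishes M Y (a ⊕ s)) →
        ∃[ s ] (s ⊆ S × Vanishes M Y (b ⊕ s)) → ∃[ s ] (s ⊆ S × Vanishes M Y ((a ⊕ b) ⊕ s))
      add a b (s , s⊆S , vs) (t , t⊆S , vt) =
        s ⊕ t , ⊕-⊆ s t s⊆S t⊆S ,
        subst (Vanishes M Y) interchange (vanishes-⊕ (a ⊕ s) (b ⊕ t) vs vt)
        where
        open ≡-Reasoning
        interchange : (a ⊕ s) ⊕ (b ⊕ t) ≡ (a ⊕ b) ⊕ (s ⊕ t)
        interchange = begin
          (a ⊕ s) ⊕ (b ⊕ t)  ≡⟨ ⊕-assoc a s (b ⊕ t) ⟩
          a ⊕ (s ⊕ (b ⊕ t))  ≡⟨ cong (a ⊕_) (⊕-assoc s b t) ⟨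
          a ⊕ ((s ⊕ b) ⊕ t)  ≡⟨ cong (λ w → a ⊕ (w ⊕ t)) (⊕-comm s b) ⟩
          a ⊕ ((b ⊕ s) ⊕ t)  ≡⟨ cong (a ⊕_) (⊕-assoc b s t) ⟩
          a ⊕ (b ⊕ (s ⊕ t))  ≡⟨ ⊕-assoc a b (s ⊕ t) ⟨
          (a ⊕ b) ⊕ (s ⊕ t)  ∎

      single : ∀ {x} → x ∈ X → ¬ ¬ (∃[ s ] (s ⊆ S × Vanishes M Y (⁅ x ⁆ ⊕ s)))
      single {x} x∈X ∄s = <-irrefl ∣S∣≡rank
        (<-≤-trans (p⊂q⇒∣p∣<∣q∣ (q⊆p∪q ⁅ x ⁆ S , x , p⊆p∪q S (x∈⁅x⁆ x) , x∉S))
                   (independent⇒∣∣≤rank S′⊆X indS′))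
        where
        x∉S : x ∉ S
        x∉S x∈S = ∄s (⁅ x ⁆ , ⁅x⁆⊆ x∈S , subst (Vanishes M Y) (sym (⊕-same ⁅ x ⁆)) vanishes-⊥)

        S′⊆X : ⁅ x ⁆ ∪ S ⊆ X
        S′⊆X p = [ ⁅x⁆⊆ x∈X , S⊆X ]′ (x∈p∪q⁻ ⁅ x ⁆ S p)

        indS′ : Independent M Y (⁅ x ⁆ ∪ S)
        indS′ c (c⊆ , vc) with x ∈? c
        -- A relation that uses `x` expresses row `x` through rows of `S`; one that does not is a
        -- relation within `S`.
        ... | yes x∈c = ⊥-elim
          (∄s (⁅ x ⁆ ⊕ c , s⊆S , subst (Vanishes M Y) (sym (⊕-cancelˡ ⁅ x ⁆ c)) vc))
          where
          s⊆S : ⁅ x ⁆ ⊕ c ⊆ S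
          s⊆S {y} p with x∈p∪q⁻ ⁅ x ⁆ S (⊕-⊆ ⁅ x ⁆ c (p⊆p∪q S) c⊆ p)
          ... | inj₂ y∈S = y∈S
          ... | inj₁ y∈⁅x⁆ with refl ← x∈⁅y⁆⇒x≡y x y∈⁅x⁆ = contradiction p (x∉⁅x⁆⊕a c x∈c)
        ... | no x∉c = indS c (c⊆S , vc)
          where
          c⊆S : c ⊆ S
          c⊆S {y} p with x∈p∪q⁻ ⁅ x ⁆ S (c⊆ p)
          ... | inj₂ y∈S = y∈S
          ... | inj₁ y∈⁅x⁆ with refl ← x∈⁅y⁆⇒x≡y x y∈⁅x⁆ = contradiction p x∉c

    rank≤∣X∣ : rank M X Y ≤ ∣ X ∣
    rank≤∣X∣ with S , S⊆X , _ , eq ← basis = subst (_≤ ∣ X ∣) eq (p⊆q⇒∣p∣≤∣q∣ S⊆X)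

-- Row rank against column rank.

∈-tabulate-∩ : (f : Fin n → Bool) (S : Subset n) {i : Fin n} → i ∈ S →
  lookup (tabulate f ∩ S) i ≡ f i
∈-tabulate-∩ f S {i} i∈S = begin
  lookup (tabulate f ∩ S) i          ≡⟨ lookup-zipWith _∧_ i (tabulate f) S ⟩
  lookup (tabulate f) i ∧ lookup S i ≡⟨ cong₂ _∧_ (lookup∘tabulate f i) ([]=⇒lookup i∈S) ⟩
  f i ∧ true                         ≡⟨ ∧-identityʳ (f i) ⟩
  f i                                ∎
  where open ≡-Reasoning

-- If S is a basis of the rows X, then a combination d of columns of Y vanishing on S
-- vanishes on X.  Hence, for independent columns T, restricting column combinations to S
-- is injective on subsets of T, which gives 2 ^ ∣ T ∣ ≤ 2 ^ ∣ S ∣.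
rank-transpose-≤ : (M : Matrix m n) (N : Matrix n m) → (∀ i j → N j i ≡ M i j) →
  ∀ X Y → rank N Y X ≤ rank M X Y
rank-transpose-≤ {m} {n} M N N≡Mᵀ X Y
  with S , S⊆X , indS , ∣S∣≡rank ← basis M Y X
  with T , T⊆Y , indT , ∣T∣≡rank ← basis N X Y =
  subst₂ _≤_ ∣T∣≡rank ∣S∣≡rank (2^-cancel-≤ (subst₂ _≤_ (length-powerset T) (length-powerset S)
    (length-injection restrict (unique-powerset T)
      (λ {d} _ → ∈-powerset⁺ S (p∩q⊆q (tabulate (λ i → ⟨ d , M i ⟩)) S))
      (λ {d} {d′} p q eq → ⊕≡⊥⇒≡ d d′ (indT (d ⊕ d′)
        (⊕-⊆ d d′ (∈-powerset⁻ T p) (∈-powerset⁻ T q) ,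
         λ {i} i∈X → trans (sum-cong-≗ (λ j → cong (lookup (d ⊕ d′) j ∧_) (N≡Mᵀ i j)))
           (extend (d ⊕ d′) (T⊆Y ∘ ⊕-⊆ d d′ (∈-powerset⁻ T p) (∈-powerset⁻ T q))
                   (agree d d′ eq) i∈X)))))))
  where
  -- The values of the column combination `d` on the rows `S`, encoded as a subset of `S` so that
  -- there are at most `2 ^ ∣ S ∣` of them.
  restrict : Subset n → Subset m
  restrict d = tabulate (λ i → ⟨ d , M i ⟩) ∩ S

  agree : ∀ d d′ → restrict d ≡ restrict d′ → ∀ {i} → i ∈ S → ⟨ d ⊕ d′ , M i ⟩ ≡ false
  agree d d′ eq {i} i∈S = begin
    ⟨ d ⊕ d′ , M i ⟩                ≡⟨ ⟨,⟩-⊕ d d′ (M i) ⟩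
    ⟨ d , M i ⟩ xor ⟨ d′ , M i ⟩    ≡⟨ cong (_xor ⟨ d′ , M i ⟩) same ⟩
    ⟨ d′ , M i ⟩ xor ⟨ d′ , M i ⟩   ≡⟨ xor-same ⟨ d′ , M i ⟩ ⟩
    false                           ∎
    where
    open ≡-Reasoning
    same : ⟨ d , M i ⟩ ≡ ⟨ d′ , M i ⟩
    same = trans (sym (∈-tabulate-∩ (λ i → ⟨ d , M i ⟩) S i∈S))
      (trans (cong (λ c → lookup c i) eq) (∈-tabulate-∩ (λ i → ⟨ d′ , M i ⟩) S i∈S))

  extend : ∀ d → d ⊆ Y → (∀ {i} → i ∈ S → ⟨ d , M i ⟩ ≡ false) →
    ∀ {x} → x ∈ X → ⟨ d , M x ⟩ ≡ false
  extend d d⊆Y d⊥S {x} x∈X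
    -- On `Y`, row `x` agrees with the combination `s` of basis rows. Adding the zero contribution
    -- of `s` turns the entry at `x` into a pairing with `⁅ x ⁆ ⊕ s`, which vanishes after the sums
    -- are interchanged.
    with s , s⊆S , vs ← basis-spans M Y X S⊆X indS ∣S∣≡rank (⁅x⁆⊆ x∈X) = begin
    ⟨ d , M x ⟩                             ≡⟨ xor-identityʳ _ ⟨
    ⟨ d , M x ⟩ xor false                   ≡⟨ cong₂ _xor_ (⟨,⟩-⁅⁆ x Md) (⟨,⟩-zero s {Md} (d⊥S ∘ s⊆S)) ⟨
    ⟨ ⁅ x ⁆ , Md ⟩ xor ⟨ s , Md ⟩           ≡⟨ ⟨,⟩-⊕ ⁅ x ⁆ s Md ⟨
    ⟨ ⁅ x ⁆ ⊕ s , Md ⟩                      ≡⟨ ⟨,⟩-adjoint M (⁅ x ⁆ ⊕ s) d ⟩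
    ⟨ d , (λ j → ⟨ ⁅ x ⁆ ⊕ s , flip M j ⟩) ⟩ ≡⟨ ⟨,⟩-zero d (vs ∘ d⊆Y) ⟩
    false                                   ∎
    where
    open ≡-Reasoning
    Md : Fin m → Bool
    Md i = ⟨ d , M i ⟩

-- Left kernels, rank-nullity and submodularity of the rank.

kernel : Matrix m n → Subset m → Subset n → List (Subset m)
kernel M X Y = filter (vanishes? M Y) (powerset X)

module _ (M : Matrix m n) where

  ∈-kernel⁺ : ∀ X Y {c} → c ⊆ X → Vanishes M Y c → c ∈ᴸ kernel M X Y
  ∈-kernel⁺ X Y c⊆X vc = ∈-filter⁺ (vanishes? M Y) (∈-powerset⁺ X c⊆X) vc

  ∈-kernel⁻ : ∀ X Y {c} → c ∈ᴸ kernel M X Y → c ⊆ X × Vanishes M Y c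
  ∈-kernel⁻ X Y c∈ with p , vc ← ∈-filter⁻ (vanishes? M Y) {xs = powerset X} c∈ =
    ∈-powerset⁻ X p , vc

  unique-kernel : ∀ X Y → Unique (kernel M X Y)
  unique-kernel X Y = Unique.filter⁺ (vanishes? M Y) (unique-powerset X)

  -- Each `c ⊆ X` splits into a kernel element and a combination of basis rows, and the two summands
  -- determine `c`. The product form avoids subtracting exponents.
  rank-nullity-≥ : ∀ X Y → 2 ^ ∣ X ∣ ≤ length (kernel M X Y) * 2 ^ rank M X Y
  rank-nullity-≥ X Y with S , S⊆X , indS , ∣S∣≡rank ← basis M Y X =
    subst₂ _≤_ (length-powerset X)
      (trans (length-cartesianProductWith _,_ (kernel M X Y) (powerset S))
             (cong (length (kernel M X Y) *_) (trans (length-powerset S) (cong (2 ^_) ∣S∣≡rank))))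
      (length-injection (λ c → c ⊕ proj c , proj c) (unique-powerset X) maps inj)
    where
    proj? : ∀ c → Decidable (λ s → s ⊆ S × Vanishes M Y (c ⊕ s))
    proj? c s = s ⊆? S ×-dec vanishes? M Y (c ⊕ s)

    proj : Subset m → Subset m
    proj c = choose (proj? c)

    maps : ∀ {c} → c ∈ᴸ powerset X →
      (c ⊕ proj c , proj c) ∈ᴸ cartesianProduct (kernel M X Y) (powerset S)
    maps {c} p
      with s , s-proj ← basis-spans M Y X S⊆X indS ∣S∣≡rank (∈-powerset⁻ X p)
      with proj⊆S , v ← choose-sat (proj? c) {s} s-proj =
      ∈-cartesianProduct⁺
        (∈-kernel⁺ X Y (⊕-⊆ c (proj c) (∈-powerset⁻ X p) (S⊆X ∘ proj⊆S)) v)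
        (∈-powerset⁺ S proj⊆S)

    inj : ∀ {c c′} → c ∈ᴸ powerset X → c′ ∈ᴸ powerset X →
      (c ⊕ proj c , proj c) ≡ (c′ ⊕ proj c′ , proj c′) → c ≡ c′
    inj {c} {c′} _ _ eq with eq₁ , eq₂ ← ,-injective eq =
      trans (sym (⊕-cancelʳ c (proj c))) (trans (cong₂ _⊕_ eq₁ eq₂) (⊕-cancelʳ c′ (proj c′)))

  -- Adding kernel elements to combinations of a basis `S` is injective: if two sums agree, `s ⊕ s′`
  -- equals `k ⊕ k′`, so it lies in the kernel and is zero by independence of `S`.
  rank-nullity-≤ : ∀ X Y → length (kernel M X Y) * 2 ^ rank M X Y ≤ 2 ^ ∣ X ∣
  rank-nullity-≤ X Y with S , S⊆X , indS , ∣S∣≡rank ← basis M Y X =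
    subst₂ _≤_
      (trans (length-cartesianProductWith _,_ (kernel M X Y) (powerset S))
             (cong (length (kernel M X Y) *_) (trans (length-powerset S) (cong (2 ^_) ∣S∣≡rank))))
      (length-powerset X)
      (length-injection (λ (k , s) → k ⊕ s)
        (Unique.cartesianProduct⁺ (unique-kernel X Y) (unique-powerset S)) maps inj)
    where
    members : ∀ {k s} → (k , s) ∈ᴸ cartesianProduct (kernel M X Y) (powerset S) →
      k ⊆ X × Vanishes M Y k × s ⊆ S
    members p
      with k∈ , s∈ ← ∈-cartesianProduct⁻ (kernel M X Y) (powerset S) p
      with k⊆X , vk ← ∈-kernel⁻ X Y k∈ = k⊆X , vk , ∈-powerset⁻ S s∈

    maps : ∀ {ks} → ks ∈ᴸ cartesianProduct (kernel M X Y) (powerset S) →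
      proj₁ ks ⊕ proj₂ ks ∈ᴸ powerset X
    maps {k , s} p with k⊆X , _ , s⊆S ← members p = ∈-powerset⁺ X (⊕-⊆ k s k⊆X (S⊆X ∘ s⊆S))

    inj : ∀ {ks ks′} → ks ∈ᴸ cartesianProduct (kernel M X Y) (powerset S) →
      ks′ ∈ᴸ cartesianProduct (kernel M X Y) (powerset S) →
      proj₁ ks ⊕ proj₂ ks ≡ proj₁ ks′ ⊕ proj₂ ks′ → ks ≡ ks′
    inj {k , s} {k′ , s′} p q eq
      with _ , vk , s⊆S ← members p
      with _ , vk′ , s′⊆S ← members q = cong₂ _,_ k≡k′ s≡s′
      where
      open ≡-Reasoning
      k⊕k′≡s⊕s′ : k ⊕ k′ ≡ s ⊕ s′
      k⊕k′≡s⊕s′ = begin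
        k ⊕ k′                ≡⟨ cong (_⊕ k′) (⊕-cancelʳ k s) ⟨
        ((k ⊕ s) ⊕ s) ⊕ k′    ≡⟨ cong (λ w → (w ⊕ s) ⊕ k′) eq ⟩
        ((k′ ⊕ s′) ⊕ s) ⊕ k′  ≡⟨ ⊕-comm _ k′ ⟩
        k′ ⊕ ((k′ ⊕ s′) ⊕ s)  ≡⟨ cong (k′ ⊕_) (⊕-assoc k′ s′ s) ⟩
        k′ ⊕ (k′ ⊕ (s′ ⊕ s))  ≡⟨ ⊕-cancelˡ k′ (s′ ⊕ s) ⟩
        s′ ⊕ s                ≡⟨ ⊕-comm s′ s ⟩
        s ⊕ s′                ∎
      s≡s′ : s ≡ s′
      s≡s′ = ⊕≡⊥⇒≡ s s′ (indS (s ⊕ s′) (⊕-⊆ s s′ s⊆S s′⊆S ,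
        subst (Vanishes M Y) k⊕k′≡s⊕s′ (vanishes-⊕ M Y k k′ vk vk′)))
      k≡k′ : k ≡ k′
      k≡k′ = trans (sym (⊕-cancelʳ k s)) (trans (cong₂ _⊕_ eq s≡s′) (⊕-cancelʳ k′ s′))

  -- ∣U∣ ∣W∣ ≤ ∣U ∩ W∣ ∣U + W∣ for the kernels U, W: send (u , w) to u ⊕ w together with the
  -- difference of u and a U-part chosen for u ⊕ w.
  kernel-modular : ∀ X₁ Y₁ X₂ Y₂ →
    length (kernel M X₁ Y₁) * length (kernel M X₂ Y₂) ≤
    length (kernel M (X₁ ∩ X₂) (Y₁ ∪ Y₂)) * length (kernel M (X₁ ∪ X₂) (Y₁ ∩ Y₂))
  kernel-modular X₁ Y₁ X₂ Y₂ = subst₂ _≤_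
    (length-cartesianProductWith _,_ U W)
    (length-cartesianProductWith _,_ U∩W U+W)
    (length-injection (λ (u , w) → u ⊕ part (u ⊕ w) , u ⊕ w)
      (Unique.cartesianProduct⁺ (unique-kernel X₁ Y₁) (unique-kernel X₂ Y₂)) maps (λ _ _ → inj))
    where
    U W U∩W U+W : List (Subset m)
    U   = kernel M X₁ Y₁
    W   = kernel M X₂ Y₂
    U∩W = kernel M (X₁ ∩ X₂) (Y₁ ∪ Y₂)
    U+W = kernel M (X₁ ∪ X₂) (Y₁ ∩ Y₂)

    -- `u` is a U-part of `c` when `u` lies in `U` and the rest `u ⊕ c` lies in `W`.
    Part : Subset m → Subset m → Set
    Part c u = (u ⊆ X₁ × Vanishes M Y₁ u) × (u ⊕ c ⊆ X₂ × Vanishes M Y₂ (u ⊕ c))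

    part? : ∀ c → Decidable (Part c)
    part? c u = (u ⊆? X₁ ×-dec vanishes? M Y₁ u) ×-dec
                (u ⊕ c ⊆? X₂ ×-dec vanishes? M Y₂ (u ⊕ c))

    part : Subset m → Subset m
    part c = choose (part? c)

    maps : ∀ {uw} → uw ∈ᴸ cartesianProduct U W →
      (proj₁ uw ⊕ part (proj₁ uw ⊕ proj₂ uw) , proj₁ uw ⊕ proj₂ uw) ∈ᴸ cartesianProduct U∩W U+W
    maps {u , w} p
      with u∈ , w∈ ← ∈-cartesianProduct⁻ U W p
      with u⊆ , vu ← ∈-kernel⁻ X₁ Y₁ u∈
      with w⊆ , vw ← ∈-kernel⁻ X₂ Y₂ w∈
      with (u′⊆ , vu′) , (w′⊆ , vw′) ← choose-sat (part? (u ⊕ w)) {u}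
        ((u⊆ , vu) , subst (λ w → w ⊆ X₂ × Vanishes M Y₂ w) (sym (⊕-cancelˡ u w)) (w⊆ , vw)) =
      ∈-cartesianProduct⁺
        (∈-kernel⁺ (X₁ ∩ X₂) (Y₁ ∪ Y₂)
          (λ x∈ → x∈p∩q⁺ (⊕-⊆ u u′ u⊆ u′⊆ x∈ , subst (_⊆ X₂) diff (⊕-⊆ w w′ w⊆ w′⊆) x∈))
          (λ y∈ → [ vanishes-⊕ M Y₁ u u′ vu vu′
                  , subst (Vanishes M Y₂) diff (vanishes-⊕ M Y₂ w w′ vw vw′) ]′ (x∈p∪q⁻ Y₁ Y₂ y∈)))
        (∈-kernel⁺ (X₁ ∪ X₂) (Y₁ ∩ Y₂)
          (⊕-⊆ u w (p⊆p∪q X₂ ∘ u⊆) (q⊆p∪q X₁ X₂ ∘ w⊆))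
          (vanishes-⊕ M (Y₁ ∩ Y₂) u w (vu ∘ p∩q⊆p Y₁ Y₂) (vw ∘ p∩q⊆q Y₁ Y₂)))
      where
      open ≡-Reasoning
      u′ w′ : Subset m
      u′ = part (u ⊕ w)
      w′ = u′ ⊕ (u ⊕ w)
      -- Both decompositions have the same sum, so the difference of the U-parts is also the
      -- difference of the W-parts and lies in both kernels.
      diff : w ⊕ w′ ≡ u ⊕ u′
      diff = begin
        w ⊕ (u′ ⊕ (u ⊕ w))  ≡⟨ cong (w ⊕_) (⊕-assoc u′ u w) ⟨
        w ⊕ ((u′ ⊕ u) ⊕ w)  ≡⟨ cong (w ⊕_) (⊕-comm (u′ ⊕ u) w) ⟩
        w ⊕ (w ⊕ (u′ ⊕ u))  ≡⟨ ⊕-cancelˡ w (u′ ⊕ u) ⟩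
        u′ ⊕ u              ≡⟨ ⊕-comm u′ u ⟩
        u ⊕ u′              ∎

    inj : ∀ {uw uw′} →
      (proj₁ uw ⊕ part (proj₁ uw ⊕ proj₂ uw) , proj₁ uw ⊕ proj₂ uw) ≡
      (proj₁ uw′ ⊕ part (proj₁ uw′ ⊕ proj₂ uw′) , proj₁ uw′ ⊕ proj₂ uw′) → uw ≡ uw′
    inj {u , w} {u′ , w′} eq with eq₁ , eq₂ ← ,-injective eq = cong₂ _,_ u≡u′ w≡w′
      where
      u≡u′ : u ≡ u′
      u≡u′ = trans (sym (⊕-cancelʳ u (part (u ⊕ w))))
        (trans (cong₂ _⊕_ eq₁ (cong part eq₂)) (⊕-cancelʳ u′ (part (u′ ⊕ w′))))
      w≡w′ : w ≡ w′
      w≡w′ = trans (sym (⊕-cancelˡ u w)) (trans (cong₂ _⊕_ u≡u′ eq₂) (⊕-cancelˡ u′ w′))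

∣p∩q∣+∣p∪q∣ : (p q : Subset n) → ∣ p ∩ q ∣ + ∣ p ∪ q ∣ ≡ ∣ p ∣ + ∣ q ∣
∣p∩q∣+∣p∪q∣ []ᵛ []ᵛ = refl
∣p∩q∣+∣p∪q∣ (inside  ∷ᵛ p) (inside  ∷ᵛ q) = cong suc (trans (+-suc _ _)
  (trans (cong suc (∣p∩q∣+∣p∪q∣ p q)) (sym (+-suc _ _))))
∣p∩q∣+∣p∪q∣ (inside  ∷ᵛ p) (outside ∷ᵛ q) = trans (+-suc _ _) (cong suc (∣p∩q∣+∣p∪q∣ p q))
∣p∩q∣+∣p∪q∣ (outside ∷ᵛ p) (inside  ∷ᵛ q) = trans (+-suc _ _)
  (trans (cong suc (∣p∩q∣+∣p∪q∣ p q)) (sym (+-suc _ _)))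
∣p∩q∣+∣p∪q∣ (outside ∷ᵛ p) (outside ∷ᵛ q) = ∣p∩q∣+∣p∪q∣ p q

-- After exponentiation, rank-nullity trades ranks for kernel sizes, which `kernel-modular`
-- compares. The remaining powers cancel because `∣ X₁ ∩ X₂ ∣ + ∣ X₁ ∪ X₂ ∣` equals
-- `∣ X₁ ∣ + ∣ X₂ ∣`.
rank-submodular : (M : Matrix m n) → ∀ X₁ Y₁ X₂ Y₂ →
  rank M (X₁ ∩ X₂) (Y₁ ∪ Y₂) + rank M (X₁ ∪ X₂) (Y₁ ∩ Y₂) ≤ rank M X₁ Y₁ + rank M X₂ Y₂
rank-submodular M X₁ Y₁ X₂ Y₂ =
  2^-cancel-≤ (*-cancelˡ-≤ (2 ^ size) {{m^n≢0 2 size}} (begin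
    2 ^ size * 2 ^ (ρ∩ + ρ∪)
      ≡⟨ cong₂ _*_ (^-distribˡ-+-* 2 ∣ X₁ ∣ ∣ X₂ ∣) (^-distribˡ-+-* 2 ρ∩ ρ∪) ⟩
    (2 ^ ∣ X₁ ∣ * 2 ^ ∣ X₂ ∣) * (2 ^ ρ∩ * 2 ^ ρ∪)
      ≤⟨ *-monoˡ-≤ _ (*-mono-≤ (rank-nullity-≥ M X₁ Y₁) (rank-nullity-≥ M X₂ Y₂)) ⟩
    (k₁ * 2 ^ ρ₁) * (k₂ * 2 ^ ρ₂) * (2 ^ ρ∩ * 2 ^ ρ∪)
      ≡⟨ cong (_* (2 ^ ρ∩ * 2 ^ ρ∪)) ([m*n]*[o*p]≡[m*o]*[n*p] k₁ (2 ^ ρ₁) k₂ (2 ^ ρ₂)) ⟩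
    (k₁ * k₂) * (2 ^ ρ₁ * 2 ^ ρ₂) * (2 ^ ρ∩ * 2 ^ ρ∪)
      ≤⟨ *-monoˡ-≤ _ (*-monoˡ-≤ _ (kernel-modular M X₁ Y₁ X₂ Y₂)) ⟩
    (k∩ * k∪) * (2 ^ ρ₁ * 2 ^ ρ₂) * (2 ^ ρ∩ * 2 ^ ρ∪)
      ≡⟨ rearrange (k∩ * k∪) (2 ^ ρ₁ * 2 ^ ρ₂) (2 ^ ρ∩ * 2 ^ ρ∪) ⟩
    (k∩ * k∪) * (2 ^ ρ∩ * 2 ^ ρ∪) * (2 ^ ρ₁ * 2 ^ ρ₂)
      ≡⟨ cong (_* (2 ^ ρ₁ * 2 ^ ρ₂)) ([m*n]*[o*p]≡[m*o]*[n*p] k∩ k∪ (2 ^ ρ∩) (2 ^ ρ∪)) ⟩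
    (k∩ * 2 ^ ρ∩) * (k∪ * 2 ^ ρ∪) * (2 ^ ρ₁ * 2 ^ ρ₂)
      ≤⟨ *-monoˡ-≤ _ (*-mono-≤ (rank-nullity-≤ M (X₁ ∩ X₂) (Y₁ ∪ Y₂))
                               (rank-nullity-≤ M (X₁ ∪ X₂) (Y₁ ∩ Y₂))) ⟩
    (2 ^ ∣ X₁ ∩ X₂ ∣ * 2 ^ ∣ X₁ ∪ X₂ ∣) * (2 ^ ρ₁ * 2 ^ ρ₂)
      ≡⟨ cong₂ _*_ (^-distribˡ-+-* 2 ∣ X₁ ∩ X₂ ∣ ∣ X₁ ∪ X₂ ∣) (^-distribˡ-+-* 2 ρ₁ ρ₂) ⟨
    2 ^ (∣ X₁ ∩ X₂ ∣ + ∣ X₁ ∪ X₂ ∣) * 2 ^ (ρ₁ + ρ₂)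
      ≡⟨ cong (λ s → 2 ^ s * 2 ^ (ρ₁ + ρ₂)) (∣p∩q∣+∣p∪q∣ X₁ X₂) ⟩
    2 ^ size * 2 ^ (ρ₁ + ρ₂) ∎))
  where
  open ≤-Reasoning
  size ρ∩ ρ∪ ρ₁ ρ₂ k∩ k∪ k₁ k₂ : ℕ
  size = ∣ X₁ ∣ + ∣ X₂ ∣
  ρ∩   = rank M (X₁ ∩ X₂) (Y₁ ∪ Y₂)
  ρ∪   = rank M (X₁ ∪ X₂) (Y₁ ∩ Y₂)
  ρ₁   = rank M X₁ Y₁
  ρ₂   = rank M X₂ Y₂
  k∩   = length (kernel M (X₁ ∩ X₂) (Y₁ ∪ Y₂))
  k∪   = length (kernel M (X₁ ∪ X₂) (Y₁ ∩ Y₂))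
  k₁   = length (kernel M X₁ Y₁)
  k₂   = length (kernel M X₂ Y₂)
  rearrange : ∀ a b c → a * b * c ≡ a * c * b
  rearrange a b c = trans (*-assoc a b c) (trans (cong (a *_) (*-comm b c)) (sym (*-assoc a c b)))

-- Complements, cut-rank and the closure properties of r-splits.

∁-involutive : (p : Subset n) → ∁ (∁ p) ≡ p
∁-involutive = BooleanAlgebra.¬-involutive (∪-∩-booleanAlgebra _)

∁-∩ : (p q : Subset n) → ∁ (p ∩ q) ≡ ∁ p ∪ ∁ q
∁-∩ = BooleanAlgebra.deMorgan₁ (∪-∩-booleanAlgebra _)

∁-∪ : (p q : Subset n) → ∁ (p ∪ q) ≡ ∁ p ∩ ∁ q
∁-∪ = BooleanAlgebra.deMorgan₂ (∪-∩-booleanAlgebra _)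

∣p∣+∣∁p∣≡n : (p : Subset n) → ∣ p ∣ + ∣ ∁ p ∣ ≡ n
∣p∣+∣∁p∣≡n p = trans (cong (∣ p ∣ +_) (∣∁p∣≡n∸∣p∣ p)) (m+[n∸m]≡n (∣p∣≤n p))

∣p∩q∣+∣∁p∩q∣≡∣q∣ : (p q : Subset n) → ∣ p ∩ q ∣ + ∣ ∁ p ∩ q ∣ ≡ ∣ q ∣
∣p∩q∣+∣∁p∩q∣≡∣q∣ []ᵛ []ᵛ = refl
∣p∩q∣+∣∁p∩q∣≡∣q∣ (inside  ∷ᵛ p) (inside  ∷ᵛ q) = cong suc (∣p∩q∣+∣∁p∩q∣≡∣q∣ p q)
∣p∩q∣+∣∁p∩q∣≡∣q∣ (inside  ∷ᵛ p) (outside ∷ᵛ q) = ∣p∩q∣+∣∁p∩q∣≡∣q∣ p q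
∣p∩q∣+∣∁p∩q∣≡∣q∣ (outside ∷ᵛ p) (inside  ∷ᵛ q) =
  trans (+-suc _ _) (cong suc (∣p∩q∣+∣∁p∩q∣≡∣q∣ p q))
∣p∩q∣+∣∁p∩q∣≡∣q∣ (outside ∷ᵛ p) (outside ∷ᵛ q) = ∣p∩q∣+∣∁p∩q∣≡∣q∣ p q

module _ (G : Graph n) where

  cutRank≤∣X∣ : ∀ X → cutRank G X ≤ ∣ X ∣
  cutRank≤∣X∣ X = rank≤∣X∣ (adj G) (∁ X) X

  -- The adjacency matrix is symmetric, so transposing its submatrix exchanges `X` and `∁ X`.
  -- Applied to `∁ X`, this gives the reverse inequality.
  cutRank-∁ : ∀ X → cutRank G (∁ X) ≤ cutRank G X
  cutRank-∁ X = subst (λ Z → rank (adj G) (∁ X) Z ≤ cutRank G X) (sym (∁-involutive X))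
    (rank-transpose-≤ (adj G) (adj G) (λ i j → symmetric G j i) X (∁ X))

  cutRank≤∣∁X∣ : ∀ X → cutRank G X ≤ ∣ ∁ X ∣
  cutRank≤∣∁X∣ X = subst (λ Z → cutRank G Z ≤ ∣ ∁ X ∣) (∁-involutive X)
    (≤-trans (cutRank-∁ (∁ X)) (cutRank≤∣X∣ (∁ X)))

  cutRank-submodular : ∀ A B → cutRank G (A ∩ B) + cutRank G (A ∪ B) ≤ cutRank G A + cutRank G B
  cutRank-submodular A B =
    subst₂ (λ Y Y′ → rank (adj G) (A ∩ B) Y + rank (adj G) (A ∪ B) Y′ ≤ cutRank G A + cutRank G B)
      (sym (∁-∩ A B)) (sym (∁-∪ A B))
      (rank-submodular (adj G) A (∁ A) B (∁ B))

  -- For (R2): if `A ∪ B` had cut-rank above `r`, submodularity would force that of `A ∩ B` below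
  -- `r`. Then `A ∩ B` is trivial by connectivity, although it and its complement have at least `r`
  -- elements.
  splitHypergraph-𝒦 : ∀ r → RankConnected r G → 𝒦 r (splitHypergraph r G)
  splitHypergraph-𝒦 r conn = record
    { R0 = λ X ∣X∣≤r → ≤⇒≤ᵇ (≤-trans (cutRank≤∣X∣ X) ∣X∣≤r)
    ; R1 = λ A A∈ → ≤⇒≤ᵇ (≤-trans (cutRank-∁ A) (≤ᵇ⇒≤ _ _ A∈))
    ; R2 = λ A B A∈ B∈ r≤∣A∩B∣ → ≤⇒≤ᵇ (≮⇒≥ (union-split A B (≤ᵇ⇒≤ _ _ A∈) (≤ᵇ⇒≤ _ _ B∈) r≤∣A∩B∣))
    }
    where
    union-split : ∀ A B → cutRank G A ≤ r → cutRank G B ≤ r → r ≤ ∣ A ∩ B ∣ →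
      ¬ r < cutRank G (A ∪ B)
    union-split A B ρA≤r ρB≤r r≤∣A∩B∣ r<ρ∪ = <⇒≱ ρ∩<r
      (subst (r ≤_) (sym (conn _ (A ∩ B) ρ∩<r ≤-refl)) (⊓-glb r≤∣A∩B∣ r≤∣∁∩∣))
      where
      ρ∩<r : cutRank G (A ∩ B) < r
      ρ∩<r = +-cancelʳ-< r _ r (<-≤-trans (+-monoʳ-< (cutRank G (A ∩ B)) r<ρ∪)
        (≤-trans (cutRank-submodular A B) (+-mono-≤ ρA≤r ρB≤r)))
      -- The complement of `A ∩ B` contains that of `A ∪ B`, whose size bounds the cut-rank of
      -- `A ∪ B`.
      r≤∣∁∩∣ : r ≤ ∣ ∁ (A ∩ B) ∣
      r≤∣∁∩∣ = ≤-trans (<⇒≤ r<ρ∪) (≤-trans (cutRank≤∣∁X∣ (A ∪ B))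
        (p⊆q⇒∣p∣≤∣q∣ (p⊆q⇒∁p⊇∁q (⊆-trans (p∩q⊆p A B) (p⊆p∪q B)))))

-- The closure conditions

module _ {r : ℕ} {ℰ : Hypergraph n} (K : 𝒦 r ℰ) where
  open 𝒦 K

  edge-∁⁻ : ∀ X → Edges ℰ (∁ X) → Edges ℰ X
  edge-∁⁻ X ∁X∈ = subst (Edges ℰ) (∁-involutive X) (R1 (∁ X) ∁X∈)

  edge-∩ : ∀ A B → Edges ℰ A → Edges ℰ B → r ≤ ∣ ∁ A ∩ ∁ B ∣ → Edges ℰ (A ∩ B)
  edge-∩ A B A∈ B∈ r≤ = edge-∁⁻ (A ∩ B)
    (subst (Edges ℰ) (sym (∁-∩ A B)) (R2 (∁ A) (∁ B) (R1 A A∈) (R1 B B∈) r≤))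

  edge-⊤ : Edges ℰ ⊤
  edge-⊤ = edge-∁⁻ ⊤ (R0 (∁ ⊤) (subst (_≤ r) (sym ∣∁⊤∣≡0) z≤n))
    where
    ∣∁⊤∣≡0 : ∣ ∁ (⊤ {n}) ∣ ≡ 0
    ∣∁⊤∣≡0 = trans (∣∁p∣≡n∸∣p∣ (⊤ {n})) (trans (cong (n ∸_) (∣⊤∣≡n n)) (n∸n≡0 n))

  -- The common set `Z` stays outside every partial intersection, which supplies the `r` elements
  -- for `edge-∩`. The empty intersection `⊤` avoids only the empty set, hence its separate case in
  -- `go`.
  edge-⋂ : ∀ Z → r ≤ ∣ Z ∣ → ∀ As → All (λ A → Edges ℰ A × Z ⊆ ∁ A) As → Edges ℰ (⋂ As)
  edge-⋂ Z r≤∣Z∣ As As✓ = [ (λ eq → subst (Edges ℰ) (sym eq) edge-⊤) , proj₁ ]′ (go As✓)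
    where
    go : ∀ {As} → All (λ A → Edges ℰ A × Z ⊆ ∁ A) As →
      ⋂ As ≡ ⊤ ⊎ (Edges ℰ (⋂ As) × Z ⊆ ∁ (⋂ As))
    go [] = inj₁ refl
    go {A ∷ As} ((A∈ , Z⊆∁A) ∷ As✓) with go As✓
    ... | inj₁ eq = inj₂ (subst (λ B → Edges ℰ B × Z ⊆ ∁ B)
      (sym (trans (cong (A ∩_) eq) (∩-identityʳ A))) (A∈ , Z⊆∁A))
    ... | inj₂ (B∈ , Z⊆∁B) = inj₂
      ( edge-∩ A (⋂ As) A∈ B∈
          (≤-trans r≤∣Z∣ (p⊆q⇒∣p∣≤∣q∣ λ z∈Z → x∈p∩q⁺ (Z⊆∁A z∈Z , Z⊆∁B z∈Z)))
      , λ z∈Z → p⊆q⇒∁p⊇∁q (p∩q⊆p A (⋂ As)) (Z⊆∁A z∈Z))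

  -- Starting from `S`, one edge is adjoined for each vertex of `X`. The running union and the next
  -- edge both contain `S`, so (R2) applies each time.
  edge-cover : ∀ {S X} → r ≤ ∣ S ∣ → Edges ℰ S → S ⊆ X →
    (∀ {v} → v ∈ X → ∃[ A ] (Edges ℰ A × S ⊆ A × A ⊆ X × v ∈ A)) → Edges ℰ X
  edge-cover {S} {X} r≤∣S∣ S∈ S⊆X cover =
    let U , U∈ , _ , U⊆X , covered = go (allFin n)
    in subst (Edges ℰ) (⊆-antisym U⊆X (λ {v} → covered (∈-allFin v))) U∈
    where
    go : ∀ vs → ∃[ U ] (Edges ℰ U × S ⊆ U × U ⊆ X × (∀ {v} → v ∈ᴸ vs → v ∈ X → v ∈ U))
    go [] = S , S∈ , ⊆-refl , S⊆X , λ ()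
    go (v ∷ vs) with U , U∈ , S⊆U , U⊆X , covered ← go vs | v ∈? X
    ... | no v∉X = U , U∈ , S⊆U , U⊆X , λ
      { (here refl) v∈X → contradiction v∈X v∉X
      ; (there p)   → covered p }
    ... | yes v∈X with A , A∈ , S⊆A , A⊆X , v∈A ← cover v∈X =
      U ∪ A
      , R2 U A U∈ A∈ (≤-trans r≤∣S∣ (p⊆q⇒∣p∣≤∣q∣ λ p → x∈p∩q⁺ (S⊆U p , S⊆A p)))
      , p⊆p∪q A ∘ S⊆U
      , (λ p → [ U⊆X , A⊆X ]′ (x∈p∪q⁻ U A p))
      , λ { (here refl) _  → q⊆p∪q U A v∈A
          ; (there p) v′∈X → p⊆p∪q A (covered p v′∈X) }

⋂-lower : {As : List (Subset n)} {A : Subset n} → A ∈ᴸ As → ⋂ As ⊆ A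
⋂-lower {As = A ∷ As} (here refl) = p∩q⊆p A (⋂ As)
⋂-lower {As = A ∷ As} (there p)   = ⋂-lower p ∘ p∩q⊆q A (⋂ As)

⋂-greatest : {As : List (Subset n)} {S : Subset n} → All (S ⊆_) As → S ⊆ ⋂ As
⋂-greatest []          _ = ∈⊤
⋂-greatest (S⊆A ∷ S⊆As) p = x∈p∩q⁺ (S⊆A p , ⋂-greatest S⊆As p)

-- Small vertex sets and hypergraphs given by lists.

prefix : ℕ → (n : ℕ) → Subset n
prefix zero    n       = ⊥
prefix (suc k) zero    = []ᵛ
prefix (suc k) (suc n) = inside ∷ᵛ prefix k n

∣prefix∣ : ∀ k n → ∣ prefix k n ∣ ≡ k ⊓ n
∣prefix∣ zero    n       = ∣⊥∣≡0 n
∣prefix∣ (suc k) zero    = refl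
∣prefix∣ (suc k) (suc n) = cong suc (∣prefix∣ k n)

-- Enumeration by `k`-tuples with repetition gives length exactly `n ^ k`; a set may occur several
-- times or have fewer than `k` elements.
tupleSets : ℕ → (n : ℕ) → List (Subset n)
tupleSets zero    n = ⊥ ∷ []
tupleSets (suc k) n = cartesianProductWith (λ v S → ⁅ v ⁆ ∪ S) (allFin n) (tupleSets k n)

length-tupleSets : ∀ k n → length (tupleSets k n) ≡ n ^ k
length-tupleSets zero    n = refl
length-tupleSets (suc k) n = trans
  (length-cartesianProductWith (λ v S → ⁅ v ⁆ ∪ S) (allFin n) (tupleSets k n))
  (cong₂ _*_ (length-tabulate {n = n} id) (length-tupleSets k n))

-- Greedy choice: as long as `S` is smaller than `X`, some vertex of `X` lies outside `S`.
subset-of-size : ∀ k {X : Subset n} → k ≤ ∣ X ∣ →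
  ∃[ S ] (S ∈ᴸ tupleSets k n × S ⊆ X × ∣ S ∣ ≡ k)
subset-of-size {n} zero _ = ⊥ , here refl , ⊥⊆ , ∣⊥∣≡0 n
subset-of-size {n} (suc k) {X} k<∣X∣
  with S , S∈ , S⊆X , ∣S∣≡k ← subset-of-size k {X} (<⇒≤ k<∣X∣)
  with anyFin? (λ v → v ∈? X ×-dec ¬? (v ∈? S))
... | no ∄v = contradiction
  (p⊆q⇒∣p∣≤∣q∣ {p = X} {q = S} λ {v} v∈X → decidable-stable (v ∈? S) λ v∉S → ∄v (v , v∈X , v∉S))
  (<⇒≱ (subst (_< ∣ X ∣) (sym ∣S∣≡k) k<∣X∣))
... | yes (v , v∈X , v∉S) =
  ⁅ v ⁆ ∪ S
  , ∈-cartesianProductWith⁺ _ (∈-allFin v) S∈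
  , (λ p → [ ⁅x⁆⊆ v∈X , S⊆X ]′ (x∈p∪q⁻ ⁅ v ⁆ S p))
  , trans (cong (_+ ∣ ⁅ v ⁆ ∪ S ∣) (sym ∣∩∣≡0))
      (trans (∣p∩q∣+∣p∪q∣ ⁅ v ⁆ S) (cong₂ _+_ (∣⁅x⁆∣≡1 v) ∣S∣≡k))
  where
  ∣∩∣≡0 : ∣ ⁅ v ⁆ ∩ S ∣ ≡ 0
  ∣∩∣≡0 = trans (cong ∣_∣ (Empty-unique λ (x , p) → v∉S
    (subst (_∈ S) (x∈⁅y⁆⇒x≡y v (proj₁ (x∈p∩q⁻ ⁅ v ⁆ S p))) (proj₂ (x∈p∩q⁻ ⁅ v ⁆ S p)))))
    (∣⊥∣≡0 n)

T-does⁻ : {P : Set} (P? : Dec P) → T (does P?) → P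
T-does⁻ (yes p) _ = p

T-does⁺ : {P : Set} (P? : Dec P) → P → T (does P?)
T-does⁺ (yes _) _ = _
T-does⁺ (no ¬p) p = ¬p p

_∈ᴸ?_ : (X : Subset n) (Xs : List (Subset n)) → Dec (X ∈ᴸ Xs)
_∈ᴸ?_ = DecMembership._∈?_ (Vec.≡-dec _≟ᵇ_)

fromList : List (Subset n) → Hypergraph n
fromList Xs X = does (X ∈ᴸ? Xs)

numEdges-fromList : (Xs : List (Subset n)) → numEdges (fromList Xs) ≤ length Xs
numEdges-fromList {n} Xs = length-injection id
  (Unique.filter⁺ (T? ∘ fromList Xs) (unique-subsets n))
  (λ {X} X∈ → T-does⁻ (X ∈ᴸ? Xs)
    (proj₂ (∈-filter⁻ (T? ∘ fromList Xs) {xs = subsets n} X∈)))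
  (λ _ _ eq → eq)

-- Hulls and the generating hypergraph.

module _ (r : ℕ) (G : Graph n) where

  IsHullCandidate : Subset n → Subset n → Pred (Subset n) 0ℓ
  IsHullCandidate Z S A = (Edges (splitHypergraph r G) A × Z ⊆ ∁ A) × S ⊆ A

  isHullCandidate? : ∀ Z S → Decidable (IsHullCandidate Z S)
  isHullCandidate? Z S A = (T? (splitHypergraph r G A) ×-dec Z ⊆? ∁ A) ×-dec S ⊆? A

  -- Pitfall: if no r-split contains S and avoids Z, this is the empty intersection ⊤; if
  -- ∣ Z ∣ < r, it need not be an r-split.
  hull : Subset n → Subset n → Subset n
  hull Z S = ⋂ (filter (isHullCandidate? Z S) (subsets n))

  ⊆-hull : ∀ Z S → S ⊆ hull Z S
  ⊆-hull Z S = ⋂-greatest (All.map proj₂ (all-filter (isHullCandidate? Z S) (subsets n)))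

  hull-⊆ : ∀ {Z S A} → IsHullCandidate Z S A → hull Z S ⊆ A
  hull-⊆ {Z} {S} {A} A✓ = ⋂-lower (∈-filter⁺ (isHullCandidate? Z S) (∈-subsets A) A✓)

  hull-edge : 𝒦 r (splitHypergraph r G) → ∀ Z S → r ≤ ∣ Z ∣ →
    Edges (splitHypergraph r G) (hull Z S)
  hull-edge K Z S r≤∣Z∣ = edge-⋂ K Z r≤∣Z∣ _
    (All.map proj₁ (all-filter (isHullCandidate? Z S) (subsets n)))

  hulls : List (Subset n)
  hulls = cartesianProductWith hull (powerset (prefix (2 * r) n)) (tupleSets (suc r) n)

  -- Filtering discards hulls that are not r-splits, as may happen for small `Z`. The hulls needed
  -- for generation survive by `hull-edge`.
  generators : List (Subset n)
  generators = filter (T? ∘ splitHypergraph r G) hulls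

  length-generators : length generators ≤ 2 ^ (2 * r) * n ^ suc r
  length-generators = begin
    length generators
      ≤⟨ length-filter (T? ∘ splitHypergraph r G) hulls ⟩
    length hulls
      ≡⟨ length-cartesianProductWith hull (powerset (prefix (2 * r) n)) (tupleSets (suc r) n) ⟩
    length (powerset (prefix (2 * r) n)) * length (tupleSets (suc r) n)
      ≡⟨ cong₂ _*_ (length-powerset (prefix (2 * r) n)) (length-tupleSets (suc r) n) ⟩
    2 ^ ∣ prefix (2 * r) n ∣ * n ^ suc r
      ≤⟨ *-monoˡ-≤ (n ^ suc r)
           (^-monoʳ-≤ 2 (≤-trans (≤-reflexive (∣prefix∣ (2 * r) n)) (m⊓n≤m (2 * r) n))) ⟩
    2 ^ (2 * r) * n ^ suc r ∎
    where open ≤-Reasoning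

  generators⊆splits : Edges (fromList generators) ⊆ᴾ Edges (splitHypergraph r G)
  generators⊆splits {X} X∈ = proj₂ (∈-filter⁻ (T? ∘ splitHypergraph r G) {xs = hulls}
    (T-does⁻ (X ∈ᴸ? generators) X∈))

  module _ (conn : RankConnected r G) {ℰ : Hypergraph n} (K : 𝒦 r ℰ)
    (generators⊆ℰ : Edges (fromList generators) ⊆ᴾ Edges ℰ) where

    private
      Z₀ : Subset n
      Z₀ = prefix (2 * r) n

    split-generated : ∀ {X} → Edges (splitHypergraph r G) X → r ≤ ∣ X ∣ → r ≤ ∣ ∁ X ∩ Z₀ ∣ →
      Edges ℰ X
    split-generated {X} X∈ r≤∣X∣ r≤∣Z∣ with S , S∈ , S⊆X , ∣S∣≡r ← subset-of-size r r≤∣X∣ =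
      edge-cover K (≤-reflexive (sym ∣S∣≡r)) (𝒦.R0 K S (≤-reflexive ∣S∣≡r)) S⊆X λ {v} v∈X →
        -- `S` comes from an `r`-tuple, so prepending `v` lists `S′` among the `suc r`-tuples even
        -- if `v` lies in `S`. Its hull stays inside `X` because `X` is itself a candidate.
        let S′ = ⁅ v ⁆ ∪ S
            hull-split = hull-edge (splitHypergraph-𝒦 G r conn) Z S′ r≤∣Z∣
        in hull Z S′
         , generators⊆ℰ (T-does⁺ (hull Z S′ ∈ᴸ? generators)
             (∈-filter⁺ (T? ∘ splitHypergraph r G)
               (∈-cartesianProductWith⁺ hull (∈-powerset⁺ Z₀ (p∩q⊆q (∁ X) Z₀))
                 (∈-cartesianProductWith⁺ (λ v S → ⁅ v ⁆ ∪ S) (∈-allFin v) S∈))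
               hull-split))
         , ⊆-hull Z S′ ∘ q⊆p∪q ⁅ v ⁆ S
         , hull-⊆ ((X∈ , p∩q⊆p (∁ X) Z₀) , λ p → [ ⁅x⁆⊆ v∈X , S⊆X ]′ (x∈p∪q⁻ ⁅ v ⁆ S p))
         , ⊆-hull Z S′ (p⊆p∪q S (x∈⁅x⁆ v))
      where
      Z : Subset n
      Z = ∁ X ∩ Z₀

    -- (R0) and (R1) settle the sets that are small or have a small complement. Otherwise `Z₀` has
    -- `2 * r` vertices, at least `r` of them on one side of the cut, and the other side is
    -- generated.
    splits⊆ℰ : Edges (splitHypergraph r G) ⊆ᴾ Edges ℰ
    splits⊆ℰ {X} X∈ with ≤-total ∣ X ∣ r | ≤-total ∣ ∁ X ∣ r
    ... | inj₁ ∣X∣≤r | _           = 𝒦.R0 K X ∣X∣≤r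
    ... | inj₂ _     | inj₁ ∣∁X∣≤r = edge-∁⁻ K X (𝒦.R0 K (∁ X) ∣∁X∣≤r)
    ... | inj₂ r≤∣X∣ | inj₂ r≤∣∁X∣ with r ≤? ∣ ∁ X ∩ Z₀ ∣
    ...   | yes r≤ = split-generated X∈ r≤∣X∣ r≤
    ...   | no  r≰ = edge-∁⁻ K X (split-generated (𝒦.R1 (splitHypergraph-𝒦 G r conn) X X∈) r≤∣∁X∣
      (subst (λ A → r ≤ ∣ A ∩ Z₀ ∣) (sym (∁-involutive X)) r≤∣X∩Z₀∣))
      where
      -- This rules out truncation of the prefix `Z₀`.
      2r≤n : 2 * r ≤ n
      2r≤n = subst₂ _≤_ (cong (r +_) (sym (+-identityʳ r))) (∣p∣+∣∁p∣≡n X) (+-mono-≤ r≤∣X∣ r≤∣∁X∣)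

      ∣Z₀∣≡r+r : ∣ Z₀ ∣ ≡ r + r
      ∣Z₀∣≡r+r = trans (∣prefix∣ (2 * r) n) (trans (m≤n⇒m⊓n≡m 2r≤n) (cong (r +_) (+-identityʳ r)))

      r≤∣X∩Z₀∣ : r ≤ ∣ X ∩ Z₀ ∣
      r≤∣X∩Z₀∣ = +-cancelʳ-≤ r r ∣ X ∩ Z₀ ∣ (begin
        r + r                            ≡⟨ ∣Z₀∣≡r+r ⟨
        ∣ Z₀ ∣                           ≡⟨ ∣p∩q∣+∣∁p∩q∣≡∣q∣ X Z₀ ⟨
        ∣ X ∩ Z₀ ∣ + ∣ ∁ X ∩ Z₀ ∣        ≤⟨ +-monoʳ-≤ ∣ X ∩ Z₀ ∣ (≰⇒≥ r≰) ⟩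
        ∣ X ∩ Z₀ ∣ + r                   ∎)
        where open ≤-Reasoning

theorem1 : ∀ (r : ℕ) → ∃[ C ] (0 < C ×
    (∀ (n : ℕ) (G : Graph n) → RankConnected r G →
    ∃[ H ] (numEdges H ≤ C * n ^ (suc r) ×
    cl r H ≐ Edges (splitHypergraph r G))))
theorem1 r = 2 ^ (2 * r) , m^n>0 2 (2 * r) , λ n G conn →
  fromList (generators r G) ,
  ≤-trans (numEdges-fromList (generators r G)) (length-generators r G) ,
  -- The split hypergraph is itself one of the hypergraphs being intersected.
  (λ X∈cl → X∈cl (splitHypergraph r G) (splitHypergraph-𝒦 G r conn) (generators⊆splits r G)) ,
  (λ X∈ ℰ K H⊆ℰ → splits⊆ℰ r G conn K H⊆ℰ X∈)
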